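{- Let $G=(V,E)$ be a connected graph with at least two vertices. Then the lightest tone of $G$ is $lt_G=\frac{1}{\chi(G)-1}$, where $\chi(G)$ is the chromatic number of $G$.
   Context: Graphs are finite, undirected and simple. A greyscale of $G=(V,E)$ is a map $f:V\to[0,1]$ with $0,1\in \mathrm{Im}(f)$. For $e=\{u,v\}\in E$ put $\widehat f(e)=|f(u)-f(v)|$. The contrast vector $cont(G,f)$ is the vector of all values $\widehat f(e)$, $e\in E$, listed in ascending order. Contrast vectors are compared in the lexicographical order, and $cont_{max}(G)$ is the lexicographic maximum of $cont(G,f)$ over all greyscales $f$ of $G$. The lightest tone $lt_G$ is the first component of $cont_{max}(G)$. -}

module Defs where

open import Algebra.Bundles using (CommutativeRing)
open import Data.Fin.Base using (Fin) renaming (_<_ to _<ᶠ_)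
open import Data.Fin.Properties using () renaming (_<?_ to _<ᶠ?_)
open import Data.List.Base using (List; _∷_; map; filter; allFin; cartesianProduct)
open import Data.List.Relation.Binary.Lex.NonStrict using (Lex-≤)
open import Data.List.Relation.Binary.Pointwise.Base using (Pointwise)
open import Data.Nat.Base using (ℕ) renaming (_≤_ to _≤ⁿ_)
open import Data.Product.Base using (_×_; _,_; ∃; ∃-syntax; Σ-syntax)
open import Level using (Level; 0ℓ; suc; _⊔_)
open import Relation.Binary.Bundles using (DecTotalOrder)
open import Relation.Binary.Construct.Closure.ReflexiveTransitive using (Star)
open import Relation.Binary.Core using (Rel)
open import Relation.Binary.Definitions using (Decidable; Symmetric)
open import Relation.Binary.PropositionalEquality.Core using (_≢_)
open import Relation.Binary.Structures using (IsDecTotalOrder)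
open import Relation.Nullary.Decidable.Core using (_×-dec_)
open import Relation.Nullary.Negation.Core using (¬_)
open import Relation.Unary using (Pred)
import Algebra.Construct.NaturalChoice.Max as Max
import Algebra.Definitions.RawMonoid as RawMonoid
import Data.List.Sort as Sort

-- The classical real numbers, axiomatised as a complete ordered field.  The
-- order is decidable because the reals are used classically; classically any
-- two models are isomorphic as ordered fields.  The value of _⁻¹ at 0 is left
-- unspecified.

record Reals (c ℓ₁ ℓ₂ : Level) : Set (suc (c ⊔ ℓ₁ ⊔ ℓ₂)) where
  infix  4 _≤_
  infix  8 _⁻¹
  field
    commutativeRing : CommutativeRing c ℓ₁
  open CommutativeRing commutativeRing public
    using (Carrier; _≈_; _+_; _*_; -_; _-_; 0#; 1#; +-rawMonoid)
  field
    _≤_             : Rel Carrier ℓ₂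
    isDecTotalOrder : IsDecTotalOrder _≈_ _≤_
    +-monoˡ-≤       : ∀ z {x y} → x ≤ y → x + z ≤ y + z
    *-nonNegative   : ∀ {x y} → 0# ≤ x → 0# ≤ y → 0# ≤ x * y
    0≉1             : ¬ (0# ≈ 1#)
    _⁻¹             : Carrier → Carrier
    ⁻¹-cong         : ∀ {x y} → x ≈ y → x ⁻¹ ≈ y ⁻¹
    ⁻¹-inverseʳ     : ∀ x → ¬ (x ≈ 0#) → x * x ⁻¹ ≈ 1#

  UpperBound : ∀ {p} → Pred Carrier p → Pred Carrier (c ⊔ ℓ₂ ⊔ p)
  UpperBound S b = ∀ x → S x → x ≤ b

  field
    complete : (S : Pred Carrier (c ⊔ ℓ₁ ⊔ ℓ₂)) → ∃ S → ∃ (UpperBound S) →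
               ∃[ s ] UpperBound S s × (∀ b → UpperBound S b → s ≤ b)

  decTotalOrder : DecTotalOrder c ℓ₁ ℓ₂
  decTotalOrder = record { isDecTotalOrder = isDecTotalOrder }

  open Max (DecTotalOrder.totalOrder decTotalOrder) public
    renaming (_⊔_ to max) using ()

  ∣_∣ : Carrier → Carrier
  ∣ x ∣ = max x (- x)

  fromℕ : ℕ → Carrier
  fromℕ k = k · 1#
    where open RawMonoid +-rawMonoid using () renaming (_×_ to _·_)

record Graph (n : ℕ) : Set₁ where
  field
    Adj    : Rel (Fin n) 0ℓ
    adj?   : Decidable Adj
    symm   : Symmetric Adj
    irrefl : ∀ v → ¬ Adj v v

  Connected : Set
  Connected = ∀ u v → Star Adj u v

  Colourable : ℕ → Set
  Colourable k = Σ[ c ∈ (Fin n → Fin k) ] (∀ u v → Adj u v → c u ≢ c v)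

  IsChromaticNumber : ℕ → Set
  IsChromaticNumber k = Colourable k × (∀ m → Colourable m → k ≤ⁿ m)

  -- Each edge {u , v} is listed exactly once, as the pair with u < v.
  edges : List (Fin n × Fin n)
  edges = filter (λ (u , v) → (u <ᶠ? v) ×-dec adj? u v)
                 (cartesianProduct (allFin n) (allFin n))

module _ {c ℓ₁ ℓ₂} (R : Reals c ℓ₁ ℓ₂) {n : ℕ} (G : Graph n) where
  open Reals R
  open Graph G
  open Sort decTotalOrder using (sort)

  record IsGreyscale (f : Fin n → Carrier) : Set (ℓ₁ ⊔ ℓ₂) where
    field
      nonNegative : ∀ v → 0# ≤ f v
      atMostOne   : ∀ v → f v ≤ 1#
      attains-0   : ∃[ v ] f v ≈ 0#
      attains-1   : ∃[ v ] f v ≈ 1#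

  contrast : (Fin n → Carrier) → Fin n × Fin n → Carrier
  contrast f (u , v) = ∣ f u - f v ∣

  cont : (Fin n → Carrier) → List Carrier
  cont f = sort (map (contrast f) edges)

  IsContMax : List Carrier → Set (c ⊔ ℓ₁ ⊔ ℓ₂)
  IsContMax w = (∃[ f ] IsGreyscale f × Pointwise _≈_ w (cont f))
              × (∀ g → IsGreyscale g → Lex-≤ _≈_ _≤_ (cont g) w)

  -- By antisymmetry of the lexicographic order a lightest tone is unique up
  -- to _≈_.  The existence of the maximum is part of the predicate.
  IsLightestTone : Carrier → Set (c ⊔ ℓ₁ ⊔ ℓ₂)
  IsLightestTone t = ∃[ ts ] IsContMax (t ∷ ts)

{-# OPTIONS --safe #-}

-- The set of greyscales is a finite union of polytopes on which the contrast
-- vector is affine: fix where 0 and 1 are attained, an orientation of every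
-- edge making the differences nonnegative, and an ascending order of these
-- differences.  Fourier–Motzkin elimination decides whether such a polytope is
-- empty and, if not, finds a lexicographic maximum on it, so the maximum over all
-- greyscales exists.  Its first component is at least 1 / (χ - 1), since an optimal
-- colouring c yields the greyscale c / (χ - 1).  It is at most 1 / (χ - 1), since a
-- greyscale f all of whose contrasts are at least t > 1 / (χ - 1) yields a colouring
-- ⌊f / t⌋ with χ - 1 colours.

module Submission where

open import Defs
open import Algebra.Bundles using (CommutativeRing)
open import Data.Fin.Base as Fin using (Fin; zero; suc)
import Data.Fin.Properties as Fin
open import Data.List.Base
  using (List; []; _∷_; _++_; map; concat; concatMap; cartesianProduct; cartesianProductWith; allFin)
open import Data.List.Membership.Propositional using (_∈_; find; lose)
open import Data.List.Membership.Propositional.Properties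
  using ( ∈-map⁺; ∈-map⁻; ∈-concat⁺′; ∈-concat⁻′; ∈-cartesianProduct⁺; ∈-cartesianProduct⁻
        ; ∈-cartesianProductWith⁺; ∈-cartesianProductWith⁻; ∈-allFin; ∈-filter⁺; ∈-filter⁻)
open import Data.List.Relation.Binary.Lex.NonStrict as Lex using (base; this; next)
open import Data.List.Relation.Binary.Permutation.Propositional
  using (_↭_; ↭-refl; ↭-sym; ↭-trans; prep; swap; ↭⇒↭ₛ′)
open import Data.List.Relation.Binary.Permutation.Propositional.Properties
  using (All-resp-↭; ∈-resp-↭) renaming (map⁺ to ↭-map⁺)
open import Data.List.Relation.Binary.Pointwise as Pointwise using ([]; _∷_)
open import Data.List.Relation.Unary.All as All using (All; []; _∷_)
open import Data.List.Relation.Unary.All.Properties using (concat⁺; concat⁻; map⁺; map⁻; ++⁺; ++⁻)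
open import Data.List.Relation.Unary.AllPairs using (AllPairs; []; _∷_)
import Data.List.Relation.Unary.AllPairs.Properties as AllPairs
open import Data.List.Relation.Unary.Any using (Any; here; there)
open import Data.List.Relation.Unary.Sorted.TotalOrder.Properties
  using (AllPairs⇒Sorted; Sorted⇒AllPairs; ↗↭↗⇒≋)
open import Data.Nat.Base as ℕ using (ℕ; zero; suc; s≤s; z≤n)
import Data.Nat.Properties as ℕ
open import Data.Product.Base as Product using (_×_; _,_; ∃; ∃-syntax; proj₁; proj₂)
open import Data.Sum.Base using (_⊎_; inj₁; inj₂; [_,_]′)
open import Data.Unit.Base using (tt)
open import Data.Vec.Functional as Vector using (Vector; head; tail)
open import Function.Base using (_∘_; const)
open import Level using (_⊔_)
open import Relation.Binary.Bundles using (DecTotalOrder; TotalOrder)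
open import Relation.Binary.Construct.Closure.ReflexiveTransitive using (_◅_)
open import Relation.Binary.Definitions using (tri<; tri≈; tri>)
open import Relation.Binary.PropositionalEquality.Core as ≡ using (_≡_; _≢_)
open import Relation.Nullary using (¬_; Dec; yes; no; contradiction)
open import Relation.Nullary.Decidable using (map′; _×-dec_)
open import Relation.Unary using (Pred)
import Algebra.Construct.NaturalChoice.Max as Max
import Algebra.Properties.Ring as RingProperties
import Algebra.Solver.Ring.NaturalCoefficients.Default as SemiringSolver
import Data.List.Extrema as Extrema
import Data.List.Relation.Binary.Permutation.Setoid as PermutationSetoid
import Data.List.Sort as Sort
import Relation.Binary.Properties.TotalOrder as TotalOrderProperties
import Relation.Binary.Reasoning.PartialOrder as PartialOrderReasoning

-- Enumerating the orientations and orders of a list of edges.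

module _ {a b p} {A : Set a} {B : Set b} {P : B → Set p} (f : A → List B) {xs : List A} where

  All-concatMap⁺ : (∀ {x} → x ∈ xs → All P (f x)) → All P (concatMap f xs)
  All-concatMap⁺ Pf = concat⁺ (map⁺ (All.tabulate Pf))

  All-concatMap⁻ : All P (concatMap f xs) → ∀ {x} → x ∈ xs → All P (f x)
  All-concatMap⁻ ps = All.lookup (map⁻ (concat⁻ ps))

module _ {a} {A : Set a} where

  insertions : A → List A → List (List A)
  insertions x []       = (x ∷ []) ∷ []
  insertions x (y ∷ ys) = (x ∷ y ∷ ys) ∷ map (y ∷_) (insertions x ys)

  insertions-↭ : ∀ {x} ys {zs} → zs ∈ insertions x ys → zs ↭ x ∷ ys
  insertions-↭ []       (here ≡.refl) = ↭-refl
  insertions-↭ (y ∷ ys) (here ≡.refl) = ↭-refl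
  insertions-↭ (y ∷ ys) (there zs∈) with ∈-map⁻ (y ∷_) zs∈
  ... | _ , zs∈′ , ≡.refl = ↭-trans (prep y (insertions-↭ ys zs∈′)) (swap y _ ↭-refl)

module _ {a} {A : Set a} where

  orientations : A × A → List (A × A)
  orientations e = e ∷ Product.swap e ∷ []

  -- One list for each choice of an orientation of every pair and an order of the results. There are
  -- finitely many, and each will determine a piece on which sorted contrasts are linear forms.
  arrangements : List (A × A) → List (List (A × A))
  arrangements []       = [] ∷ []
  arrangements (e ∷ es) = concat (cartesianProductWith insertions (orientations e) (arrangements es))

  arrangements-∷⁺ : ∀ {e e′} es {L L′} → e′ ∈ orientations e → L ∈ arrangements es →
                    L′ ∈ insertions e′ L → L′ ∈ arrangements (e ∷ es)
  arrangements-∷⁺ es e′∈ L∈ L′∈ = ∈-concat⁺′ L′∈ (∈-cartesianProductWith⁺ insertions e′∈ L∈)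

  arrangements-∷⁻ : ∀ {e} es {L′} → L′ ∈ arrangements (e ∷ es) →
                    ∃[ e′ ] ∃[ L ] e′ ∈ orientations e × L ∈ arrangements es × L′ ∈ insertions e′ L
  arrangements-∷⁻ {e} es L′∈
    with ∈-concat⁻′ (cartesianProductWith insertions (orientations e) (arrangements es)) L′∈
  ... | _ , L′∈′ , xs∈ with ∈-cartesianProductWith⁻ insertions (orientations e) (arrangements es) xs∈
  ...   | e′ , L , e′∈ , L∈ , ≡.refl = e′ , L , e′∈ , L∈ , L′∈′

-- Maxima over finite unions.

module _ {x ℓ₁ ℓ₂ ℓ₃} {X : Set x} (O : DecTotalOrder ℓ₁ ℓ₂ ℓ₃)
         (key : X → DecTotalOrder.Carrier O) where
  open DecTotalOrder O

  -- Emptiness is decided along with the maximum, so that a union can discard its empty pieces and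
  -- compare the maxima of the others.
  MaximumOrEmpty : ∀ {q} → Pred X q → Set (x ⊔ q ⊔ ℓ₃)
  MaximumOrEmpty S = (∃[ f ] S f × (∀ {g} → S g → key g ≤ key f)) ⊎ (∀ {g} → ¬ S g)

  maximumOrEmpty-⋃ : ∀ {a q} {A : Set a} (Q : A → Pred X q) rs → (∀ {r} → r ∈ rs → MaximumOrEmpty (Q r)) →
                     MaximumOrEmpty (λ f → Any (λ r → Q r f) rs)
  maximumOrEmpty-⋃ Q []       _    = inj₂ λ ()
  maximumOrEmpty-⋃ Q (r ∷ rs) best with best (here ≡.refl) | maximumOrEmpty-⋃ Q rs (best ∘ there)
  ... | inj₂ ¬Qr            | inj₂ ¬Qrs = inj₂ λ { (here q) → ¬Qr q ; (there q) → ¬Qrs q }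
  ... | inj₂ ¬Qr            | inj₁ (f , q , f-max) =
    inj₁ (f , there q , λ { (here q) → contradiction q ¬Qr ; (there q) → f-max q })
  ... | inj₁ (f , q , f-max) | inj₂ ¬Qrs =
    inj₁ (f , here q , λ { (here q) → f-max q ; (there q) → contradiction q ¬Qrs })
  ... | inj₁ (f , q , f-max) | inj₁ (g , p , g-max) with total (key f) (key g)
  ...   | inj₁ f≤g = inj₁ (g , there p , λ { (here q) → trans (f-max q) f≤g ; (there q) → g-max q })
  ...   | inj₂ g≤f = inj₁ (f , here q , λ { (here q) → f-max q ; (there q) → trans (g-max q) g≤f })

-- Edges and colourings of graphs.

module _ {n : ℕ} (G : Graph n) where
  open Graph G

  -- A walk between two distinct vertices has a first step.
  connected⇒edge : 2 ℕ.≤ n → Connected → ∃[ u ] ∃[ v ] Adj u v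
  connected⇒edge (s≤s (s≤s _)) connected with connected zero (suc zero)
  ... | adj ◅ _ = _ , _ , adj

  -- An unused colour could be removed.
  colour-used : ∀ {k} → (∀ m → Colourable m → suc k ℕ.≤ m) → ((c , _) : Colourable (suc k)) →
                ∀ i → ∃[ v ] c v ≡ i
  colour-used {k} minimal (c , proper) i with Fin.any? (λ v → c v Fin.≟ i)
  ... | yes used  = used
  ... | no unused = contradiction (minimal k (c′ , proper′)) ℕ.1+n≰n
    where
    i≢c : ∀ v → i ≢ c v
    i≢c v i≡cv = unused (v , ≡.sym i≡cv)

    c′ : Fin n → Fin k
    c′ v = Fin.punchOut (i≢c v)

    proper′ : ∀ u v → Adj u v → c′ u ≢ c′ v
    proper′ u v adj eq = proper u v adj (Fin.punchOut-injective (i≢c u) (i≢c v) eq)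

  ∈-edges⁻ : ∀ {u v} → (u , v) ∈ edges → Adj u v
  ∈-edges⁻ e∈ = proj₂ (proj₂ (∈-filter⁻ (λ (u , v) → (u Fin.<? v) ×-dec adj? u v)
    {xs = cartesianProduct (allFin n) (allFin n)} e∈))

  ∈-edges⁺ : ∀ {u v} → Adj u v → (u , v) ∈ edges ⊎ (v , u) ∈ edges
  ∈-edges⁺ {u} {v} adj with Fin.<-cmp u v
  ... | tri< u<v _ _ = inj₁ (∈-filter⁺ (λ (u , v) → (u Fin.<? v) ×-dec adj? u v)
    (∈-cartesianProduct⁺ (∈-allFin u) (∈-allFin v)) (u<v , adj))
  ... | tri≈ _ ≡.refl _ = contradiction adj (irrefl u)
  ... | tri> _ _ v<u = inj₂ (∈-filter⁺ (λ (u , v) → (u Fin.<? v) ×-dec adj? u v)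
    (∈-cartesianProduct⁺ (∈-allFin v) (∈-allFin u)) (v<u , symm adj))

-- Arithmetic in an ordered field.

module OrderedField {c ℓ₁ ℓ₂} (R : Reals c ℓ₁ ℓ₂) where
  open Reals R public
  open CommutativeRing commutativeRing public
    using ( refl; sym; trans; ring; commutativeSemiring
          ; +-cong; +-congˡ; +-congʳ; +-comm; +-assoc; +-identityˡ; +-identityʳ
          ; -‿cong; -‿inverseʳ
          ; *-cong; *-congˡ; *-congʳ; *-comm; *-assoc; *-identityˡ; *-identityʳ
          ; zeroˡ; zeroʳ; distribˡ; distribʳ)
  open DecTotalOrder decTotalOrder public
    using (_≟_; _≤?_; total; antisym; totalOrder; poset; ≤-respˡ-≈; ≤-respʳ-≈)
    renaming (refl to ≤-refl; trans to ≤-trans; reflexive to ≤-reflexive)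
  open RingProperties ring public
    using ( -‿involutive; -0#≈0#; -‿distribˡ-*; -1*x≈-x
          ; ⁻¹-anti-homo‿-; //-rightDividesˡ; //-rightDividesʳ; [y-z]x≈yx-zx; x[y-z]≈xy-xz)
  open TotalOrderProperties totalOrder public using (≰⇒≥)
  open Max totalOrder public using (x≤x⊔y; x≤y⊔x; ⊔-lub; ⊔-sel)
  module ≤-Reasoning = PartialOrderReasoning poset
  open ≤-Reasoning

  +-monoʳ-≤ : ∀ z {x y} → x ≤ y → z + x ≤ z + y
  +-monoʳ-≤ z {x} {y} x≤y = begin
    z + x ≈⟨ +-comm z x ⟩
    x + z ≤⟨ +-monoˡ-≤ z x≤y ⟩
    y + z ≈⟨ +-comm y z ⟩
    z + y ∎

  +-mono-≤ : ∀ {x y u v} → x ≤ y → u ≤ v → x + u ≤ y + v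
  +-mono-≤ x≤y u≤v = ≤-trans (+-monoˡ-≤ _ x≤y) (+-monoʳ-≤ _ u≤v)

  x≤y⇒0≤y-x : ∀ {x y} → x ≤ y → 0# ≤ y - x
  x≤y⇒0≤y-x {x} {y} x≤y = begin
    0#    ≈⟨ -‿inverseʳ x ⟨
    x - x ≤⟨ +-monoˡ-≤ (- x) x≤y ⟩
    y - x ∎

  0≤y-x⇒x≤y : ∀ {x y} → 0# ≤ y - x → x ≤ y
  0≤y-x⇒x≤y {x} {y} 0≤y-x = begin
    x         ≈⟨ +-identityˡ x ⟨
    0# + x    ≤⟨ +-monoˡ-≤ x 0≤y-x ⟩
    y - x + x ≈⟨ //-rightDividesˡ x y ⟩
    y         ∎

  x+y≤z⇒x≤z-y : ∀ {x y z} → x + y ≤ z → x ≤ z - y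
  x+y≤z⇒x≤z-y {x} {y} {z} x+y≤z = begin
    x         ≈⟨ //-rightDividesʳ y x ⟨
    x + y - y ≤⟨ +-monoˡ-≤ (- y) x+y≤z ⟩
    z - y     ∎

  x≤0⇒0≤-x : ∀ {x} → x ≤ 0# → 0# ≤ - x
  x≤0⇒0≤-x x≤0 = ≤-respʳ-≈ (+-identityˡ _) (x≤y⇒0≤y-x x≤0)

  *-monoʳ-≤-nonNeg : ∀ {z x y} → 0# ≤ z → x ≤ y → z * x ≤ z * y
  *-monoʳ-≤-nonNeg 0≤z x≤y = 0≤y-x⇒x≤y
    (≤-respʳ-≈ (x[y-z]≈xy-xz _ _ _) (*-nonNegative 0≤z (x≤y⇒0≤y-x x≤y)))

  *-monoˡ-≤-nonNeg : ∀ {z x y} → 0# ≤ z → x ≤ y → x * z ≤ y * z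
  *-monoˡ-≤-nonNeg 0≤z x≤y = 0≤y-x⇒x≤y
    (≤-respʳ-≈ ([y-z]x≈yx-zx _ _ _) (*-nonNegative (x≤y⇒0≤y-x x≤y) 0≤z))

  -- If 1 ≤ 0, then -1 is nonnegative, and so is its square 1.
  0≤1 : 0# ≤ 1#
  0≤1 with total 0# 1#
  ... | inj₁ 0≤1 = 0≤1
  ... | inj₂ 1≤0 = begin
    0#          ≤⟨ *-nonNegative (x≤0⇒0≤-x 1≤0) (x≤0⇒0≤-x 1≤0) ⟩
    - 1# * - 1# ≈⟨ -1*x≈-x (- 1#) ⟩
    - - 1#      ≈⟨ -‿involutive 1# ⟩
    1#          ∎

  ⁻¹-nonNegative : ∀ {x} → 0# ≤ x → ¬ x ≈ 0# → 0# ≤ x ⁻¹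
  ⁻¹-nonNegative {x} 0≤x x≉0 with total 0# (x ⁻¹)
  ... | inj₁ 0≤x⁻¹ = 0≤x⁻¹
  ... | inj₂ x⁻¹≤0 = contradiction (antisym 0≤1 1≤0) 0≉1
    where
    1≤0 : 1# ≤ 0#
    1≤0 = begin
      1#       ≈⟨ ⁻¹-inverseʳ x x≉0 ⟨
      x * x ⁻¹ ≤⟨ *-monoʳ-≤-nonNeg 0≤x x⁻¹≤0 ⟩
      x * 0#   ≈⟨ zeroʳ x ⟩
      0#       ∎

  x*[x⁻¹*y]≈y : ∀ {x} y → ¬ x ≈ 0# → x * (x ⁻¹ * y) ≈ y
  x*[x⁻¹*y]≈y {x} y x≉0 = begin-equality
    x * (x ⁻¹ * y) ≈⟨ *-assoc x (x ⁻¹) y ⟨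
    x * x ⁻¹ * y   ≈⟨ *-congʳ (⁻¹-inverseʳ x x≉0) ⟩
    1# * y         ≈⟨ *-identityˡ y ⟩
    y              ∎

  x⁻¹*[x*y]≈y : ∀ {x} y → ¬ x ≈ 0# → x ⁻¹ * (x * y) ≈ y
  x⁻¹*[x*y]≈y {x} y x≉0 = begin-equality
    x ⁻¹ * (x * y) ≈⟨ *-assoc (x ⁻¹) x y ⟨
    x ⁻¹ * x * y   ≈⟨ *-congʳ (*-comm (x ⁻¹) x) ⟩
    x * x ⁻¹ * y   ≈⟨ *-assoc x (x ⁻¹) y ⟩
    x * (x ⁻¹ * y) ≈⟨ x*[x⁻¹*y]≈y y x≉0 ⟩
    y              ∎

  ∣-∣-sel : ∀ x → ∣ x ∣ ≈ x ⊎ ∣ x ∣ ≈ - x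
  ∣-∣-sel x = ⊔-sel x (- x)

  0≤x⇒∣x∣≈x : ∀ {x} → 0# ≤ x → ∣ x ∣ ≈ x
  0≤x⇒∣x∣≈x {x} 0≤x = antisym (⊔-lub ≤-refl -x≤x) (x≤x⊔y x (- x))
    where
    -x≤x : - x ≤ x
    -x≤x = begin
      - x    ≈⟨ +-identityˡ (- x) ⟨
      0# - x ≤⟨ +-monoˡ-≤ (- x) 0≤x ⟩
      x - x  ≈⟨ -‿inverseʳ x ⟩
      0#     ≤⟨ 0≤x ⟩
      x      ∎

  ∣x-y∣≈∣y-x∣ : ∀ x y → ∣ x - y ∣ ≈ ∣ y - x ∣
  ∣x-y∣≈∣y-x∣ x y = antisym (bound x y) (bound y x)
    where
    bound : ∀ x y → ∣ x - y ∣ ≤ ∣ y - x ∣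
    bound x y = ⊔-lub
      (begin
        x - y     ≈⟨ ⁻¹-anti-homo‿- y x ⟨
        - (y - x) ≤⟨ x≤y⊔x (y - x) (- (y - x)) ⟩
        ∣ y - x ∣ ∎)
      (begin
        - (x - y) ≈⟨ ⁻¹-anti-homo‿- x y ⟩
        y - x     ≤⟨ x≤x⊔y (y - x) (- (y - x)) ⟩
        ∣ y - x ∣ ∎)

-- Linear programming by Fourier–Motzkin elimination

module LinearInequalities {c ℓ₁ ℓ₂} (R : Reals c ℓ₁ ℓ₂) where
  open OrderedField R
  open ≤-Reasoning
  open SemiringSolver commutativeSemiring using (solve; _:+_; _:*_; _:=_)
  open Extrema totalOrder using (argmin; argmin-all; f[argmin]≤f[xs])

  dot : ∀ {k} → Vector Carrier k → Vector Carrier k → Carrier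
  dot {zero}  a x = 0#
  dot {suc k} a x = head a * head x + dot (tail a) (tail x)

  dot-+ : ∀ {k} (a b x : Vector Carrier k) → dot (λ i → a i + b i) x ≈ dot a x + dot b x
  dot-+ {zero}  a b x = sym (+-identityˡ 0#)
  dot-+ {suc k} a b x = begin-equality
    (head a + head b) * head x + dot (λ i → tail a i + tail b i) (tail x)
      ≈⟨ +-congˡ (dot-+ (tail a) (tail b) (tail x)) ⟩
    (head a + head b) * head x + (dot (tail a) (tail x) + dot (tail b) (tail x))
      ≈⟨ solve 5 (λ a b x s t → (a :+ b) :* x :+ (s :+ t) := (a :* x :+ s) :+ (b :* x :+ t))
           refl (head a) (head b) (head x) _ _ ⟩
    dot a x + dot b x ∎

  dot-* : ∀ {k} s (a x : Vector Carrier k) → dot (λ i → s * a i) x ≈ s * dot a x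
  dot-* {zero}  s a x = sym (zeroʳ s)
  dot-* {suc k} s a x = begin-equality
    s * head a * head x + dot (λ i → s * tail a i) (tail x)
      ≈⟨ +-congˡ (dot-* s (tail a) (tail x)) ⟩
    s * head a * head x + s * dot (tail a) (tail x)
      ≈⟨ solve 4 (λ s a x t → s :* a :* x :+ s :* t := s :* (a :* x :+ t))
           refl s (head a) (head x) _ ⟩
    s * dot a x ∎

  dot-0 : ∀ {k} (x : Vector Carrier k) → dot (const 0#) x ≈ 0#
  dot-0 {zero}  x = refl
  dot-0 {suc k} x = trans (+-cong (zeroˡ (head x)) (dot-0 (tail x))) (+-identityˡ 0#)

  unit : ∀ {k} → Fin k → Vector Carrier k
  unit zero    = 1# Vector.∷ const 0#
  unit (suc i) = 0# Vector.∷ unit i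

  dot-unit : ∀ {k} (i : Fin k) x → dot (unit i) x ≈ x i
  dot-unit zero    x = trans (+-cong (*-identityˡ _) (dot-0 (tail x))) (+-identityʳ _)
  dot-unit (suc i) x = trans (+-cong (zeroˡ _) (dot-unit i (tail x))) (+-identityˡ _)

  -- A homogeneous linear form in k unknowns ranging over [0, 1] and p
  -- parameters.  Inhomogeneous forms arise by setting a parameter to 1.
  record Form (k p : ℕ) : Set c where
    constructor form
    field
      coef : Vector Carrier k
      par  : Vector Carrier p

  open Form

  ⟦_⟧ : ∀ {k p} → Form k p → Vector Carrier k → Vector Carrier p → Carrier
  ⟦ φ ⟧ x y = dot (coef φ) x + dot (par φ) y

  infixl 6 _⊕_
  infixl 7 _⊙_

  _⊕_ : ∀ {k p} → Form k p → Form k p → Form k p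
  φ ⊕ ψ = form (λ i → coef φ i + coef ψ i) (λ i → par φ i + par ψ i)

  _⊙_ : ∀ {k p} → Carrier → Form k p → Form k p
  s ⊙ φ = form (λ i → s * coef φ i) (λ i → s * par φ i)

  ⊕-value : ∀ {k p} (φ ψ : Form k p) x y → ⟦ φ ⊕ ψ ⟧ x y ≈ ⟦ φ ⟧ x y + ⟦ ψ ⟧ x y
  ⊕-value φ ψ x y = begin-equality
    ⟦ φ ⊕ ψ ⟧ x y
      ≈⟨ +-cong (dot-+ (coef φ) (coef ψ) x) (dot-+ (par φ) (par ψ) y) ⟩
    dot (coef φ) x + dot (coef ψ) x + (dot (par φ) y + dot (par ψ) y)
      ≈⟨ solve 4 (λ a b c d → a :+ b :+ (c :+ d) := (a :+ c) :+ (b :+ d)) refl _ _ _ _ ⟩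
    ⟦ φ ⟧ x y + ⟦ ψ ⟧ x y ∎

  ⊙-value : ∀ {k p} s (φ : Form k p) x y → ⟦ s ⊙ φ ⟧ x y ≈ s * ⟦ φ ⟧ x y
  ⊙-value s φ x y = begin-equality
    ⟦ s ⊙ φ ⟧ x y                         ≈⟨ +-cong (dot-* s (coef φ) x) (dot-* s (par φ) y) ⟩
    s * dot (coef φ) x + s * dot (par φ) y ≈⟨ distribˡ s _ _ ⟨
    s * ⟦ φ ⟧ x y                         ∎

  0̂ : ∀ {k p} → Form k p
  0̂ = form (const 0#) (const 0#)

  0̂-value : ∀ {k p} (x : Vector Carrier k) (y : Vector Carrier p) → ⟦ 0̂ ⟧ x y ≈ 0#
  0̂-value x y = trans (+-cong (dot-0 x) (dot-0 y)) (+-identityˡ 0#)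

  unknown : ∀ {k p} → Fin k → Form k p
  unknown i = form (unit i) (const 0#)

  unknown-value : ∀ {k p} (i : Fin k) x (y : Vector Carrier p) → ⟦ unknown i ⟧ x y ≈ x i
  unknown-value i x y = trans (+-cong (dot-unit i x) (dot-0 y)) (+-identityʳ (x i))

  parameter : ∀ {k p} → Fin p → Form k p
  parameter i = form (const 0#) (unit i)

  parameter-value : ∀ {k p} (i : Fin p) (x : Vector Carrier k) y → ⟦ parameter i ⟧ x y ≈ y i
  parameter-value i x y = trans (+-cong (dot-0 x) (dot-unit i y)) (+-identityˡ (y i))

  infixl 6 _⊖_

  _⊖_ : ∀ {k p} → Form k p → Form k p → Form k p
  φ ⊖ ψ = φ ⊕ (- 1#) ⊙ ψ

  ⊖-value : ∀ {k p} (φ ψ : Form k p) x y → ⟦ φ ⊖ ψ ⟧ x y ≈ ⟦ φ ⟧ x y - ⟦ ψ ⟧ x y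
  ⊖-value φ ψ x y = trans (⊕-value φ _ x y)
    (+-congˡ (trans (⊙-value (- 1#) ψ x y) (-1*x≈-x _)))

  NonNeg : ∀ {k p} → Vector Carrier k → Vector Carrier p → Form k p → Set ℓ₂
  NonNeg x y φ = 0# ≤ ⟦ φ ⟧ x y

  InBox : ∀ {k} → Vector Carrier k → Set ℓ₂
  InBox x = ∀ i → 0# ≤ x i × x i ≤ 1#

  Feasible : ∀ {k p} → List (Form k p) → Vector Carrier p → Vector Carrier k → Set (c ⊔ ℓ₂)
  Feasible P y x = InBox x × All (NonNeg x y) P

  rest : ∀ {k p} → Form (suc k) p → Form k p
  rest φ = form (tail (coef φ)) (par φ)

  rest-value : ∀ {k p} (φ : Form (suc k) p) x y →
               ⟦ φ ⟧ x y ≈ head (coef φ) * head x + ⟦ rest φ ⟧ (tail x) y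
  rest-value φ x y = +-assoc _ _ _

  -- The constraint 0 ≤ φ solved for the first unknown.
  data Bound (k p : ℕ) : Set c where
    lower upper free : Form k p → Bound k p

  -- `lower φ` bounds the unknown below by -φ. With this sign the condition that a lower bound is at
  -- most an upper bound becomes nonnegativity of the sum of the two forms.
  Holds : ∀ {k p} → Carrier → Vector Carrier k → Vector Carrier p → Bound k p → Set ℓ₂
  Holds x₀ x y (lower φ) = 0# ≤ ⟦ φ ⟧ x y + x₀
  Holds x₀ x y (upper φ) = x₀ ≤ ⟦ φ ⟧ x y
  Holds x₀ x y (free φ)  = 0# ≤ ⟦ φ ⟧ x y

  -- Dividing by the absolute value of the leading coefficient keeps the direction of the
  -- inequality; the sign of the coefficient decides on which side the unknown is bounded.
  bound : ∀ {k p} → Form (suc k) p → Bound k p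
  bound φ with head (coef φ) ≟ 0# | 0# ≤? head (coef φ)
  ... | yes _ | _     = free (rest φ)
  ... | no _  | yes _ = lower (head (coef φ) ⁻¹ ⊙ rest φ)
  ... | no _  | no _  = upper ((- head (coef φ)) ⁻¹ ⊙ rest φ)

  module _ {k p} (φ : Form (suc k) p) (x : Vector Carrier (suc k)) (y : Vector Carrier p) where
    private
      a = head (coef φ)
      r = ⟦ rest φ ⟧ (tail x) y

      scaled : ∀ s → ⟦ s ⊙ rest φ ⟧ (tail x) y ≈ s * r
      scaled s = ⊙-value s (rest φ) (tail x) y

      -a≉0 : ¬ a ≈ 0# → ¬ - a ≈ 0#
      -a≉0 a≉0 -a≈0 = a≉0 (trans (sym (-‿involutive a)) (trans (-‿cong -a≈0) -0#≈0#))

      φ≈r--a*x₀ : ⟦ φ ⟧ x y ≈ r - - a * head x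
      φ≈r--a*x₀ = begin-equality
        ⟦ φ ⟧ x y                 ≈⟨ rest-value φ x y ⟩
        a * head x + r           ≈⟨ +-comm _ r ⟩
        r + a * head x           ≈⟨ +-congˡ (-‿involutive _) ⟨
        r - - (a * head x)       ≈⟨ +-congˡ (-‿cong (-‿distribˡ-* a (head x))) ⟩
        r - - a * head x         ∎

    nonNeg⇒bound : NonNeg x y φ → Holds (head x) (tail x) y (bound φ)
    nonNeg⇒bound 0≤φ with a ≟ 0# | 0# ≤? a
    ... | yes a≈0 | _ = begin
      0#             ≤⟨ 0≤φ ⟩
      ⟦ φ ⟧ x y       ≈⟨ rest-value φ x y ⟩
      a * head x + r ≈⟨ +-congʳ (trans (*-congʳ a≈0) (zeroˡ _)) ⟩
      0# + r         ≈⟨ +-identityˡ r ⟩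
      r              ∎
    ... | no a≉0 | yes 0≤a = begin
      0#                                    ≤⟨ *-nonNegative (⁻¹-nonNegative 0≤a a≉0) 0≤φ ⟩
      a ⁻¹ * ⟦ φ ⟧ x y                       ≈⟨ *-congˡ (rest-value φ x y) ⟩
      a ⁻¹ * (a * head x + r)               ≈⟨ distribˡ _ _ _ ⟩
      a ⁻¹ * (a * head x) + a ⁻¹ * r        ≈⟨ +-cong (x⁻¹*[x*y]≈y _ a≉0) (sym (scaled _)) ⟩
      head x + ⟦ a ⁻¹ ⊙ rest φ ⟧ (tail x) y  ≈⟨ +-comm _ _ ⟩
      ⟦ a ⁻¹ ⊙ rest φ ⟧ (tail x) y + head x  ∎
    ... | no a≉0 | no 0≰a = begin
      head x
        ≈⟨ x⁻¹*[x*y]≈y _ (-a≉0 a≉0) ⟨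
      (- a) ⁻¹ * (- a * head x)
        ≤⟨ *-monoʳ-≤-nonNeg (⁻¹-nonNegative (x≤0⇒0≤-x (≰⇒≥ 0≰a)) (-a≉0 a≉0))
             (0≤y-x⇒x≤y (≤-respʳ-≈ φ≈r--a*x₀ 0≤φ)) ⟩
      (- a) ⁻¹ * r
        ≈⟨ scaled _ ⟨
      ⟦ (- a) ⁻¹ ⊙ rest φ ⟧ (tail x) y ∎

    bound⇒nonNeg : Holds (head x) (tail x) y (bound φ) → NonNeg x y φ
    bound⇒nonNeg h with a ≟ 0# | 0# ≤? a
    ... | yes a≈0 | _ = begin
      0#             ≤⟨ h ⟩
      r              ≈⟨ +-identityˡ r ⟨
      0# + r         ≈⟨ +-congʳ (trans (*-congʳ a≈0) (zeroˡ _)) ⟨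
      a * head x + r ≈⟨ rest-value φ x y ⟨
      ⟦ φ ⟧ x y       ∎
    ... | no a≉0 | yes 0≤a = begin
      0#
        ≤⟨ *-nonNegative 0≤a h ⟩
      a * (⟦ a ⁻¹ ⊙ rest φ ⟧ (tail x) y + head x)
        ≈⟨ distribˡ _ _ _ ⟩
      a * ⟦ a ⁻¹ ⊙ rest φ ⟧ (tail x) y + a * head x
        ≈⟨ +-congʳ (trans (*-congˡ (scaled _)) (x*[x⁻¹*y]≈y r a≉0)) ⟩
      r + a * head x
        ≈⟨ +-comm r _ ⟩
      a * head x + r
        ≈⟨ rest-value φ x y ⟨
      ⟦ φ ⟧ x y ∎
    ... | no a≉0 | no 0≰a = ≤-respʳ-≈ (sym φ≈r--a*x₀) (x≤y⇒0≤y-x (begin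
      - a * head x                           ≤⟨ *-monoʳ-≤-nonNeg (x≤0⇒0≤-x (≰⇒≥ 0≰a)) h ⟩
      - a * ⟦ (- a) ⁻¹ ⊙ rest φ ⟧ (tail x) y  ≈⟨ *-congˡ (scaled _) ⟩
      - a * ((- a) ⁻¹ * r)                   ≈⟨ x*[x⁻¹*y]≈y r (-a≉0 a≉0) ⟩
      r                                      ∎))

  -- Parameter 0 always has the value 1, so the first two bounds put the unknown in [0, 1].
  bounds : ∀ {k p} → List (Form (suc k) (suc p)) → List (Bound k (suc p))
  bounds P = upper (parameter zero) ∷ lower 0̂ ∷ map bound P

  -- The Fourier-Motzkin step. A free constraint survives against every partner, itself included, so
  -- it is never lost when all pairs are formed; it merely gets repeated.
  combine : ∀ {k p} → Bound k p → Bound k p → List (Form k p)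
  combine (lower φ) (upper ψ) = (φ ⊕ ψ) ∷ []
  combine (free φ)  _         = φ ∷ []
  combine _         _         = []

  combineAll : ∀ {k p} → List (Bound k p) → Bound k p → List (Form k p)
  combineAll bs b = concatMap (combine b) bs

  eliminate : ∀ {k p} → List (Form (suc k) (suc p)) → List (Form k (suc p))
  eliminate P = concatMap (combineAll (bounds P)) (bounds P)

  combine-nonNeg : ∀ {k p x₀} {x : Vector Carrier k} {y : Vector Carrier p} b b′ →
                   Holds x₀ x y b → Holds x₀ x y b′ → All (NonNeg x y) (combine b b′)
  combine-nonNeg {x₀ = x₀} {x} {y} (lower φ) (upper ψ) 0≤φ+x₀ x₀≤ψ = (begin
    0#                    ≤⟨ 0≤φ+x₀ ⟩
    ⟦ φ ⟧ x y + x₀         ≤⟨ +-monoʳ-≤ _ x₀≤ψ ⟩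
    ⟦ φ ⟧ x y + ⟦ ψ ⟧ x y   ≈⟨ ⊕-value φ ψ x y ⟨
    ⟦ φ ⊕ ψ ⟧ x y          ∎) ∷ []
  combine-nonNeg (lower _) (lower _) _ _   = []
  combine-nonNeg (lower _) (free _)  _ _   = []
  combine-nonNeg (upper _) _         _ _   = []
  combine-nonNeg (free φ)  _         0≤φ _ = 0≤φ ∷ []

  module _ {k p} (y : Vector Carrier (suc p)) (y₀≈1 : head y ≈ 1#)
           (P : List (Form (suc k) (suc p))) where

    feasible⇒bounds : ∀ {x} → Feasible P y x → All (Holds (head x) (tail x) y) (bounds P)
    feasible⇒bounds {x} (box , 0≤P) =
      ≤-respʳ-≈ (sym (trans (parameter-value zero (tail x) y) y₀≈1)) (proj₂ (box zero)) ∷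
      ≤-respʳ-≈ (sym (trans (+-congʳ (0̂-value (tail x) y)) (+-identityˡ _))) (proj₁ (box zero)) ∷
      map⁺ (All.map (λ {φ} → nonNeg⇒bound φ x y) 0≤P)

    -- The eliminated coordinate lies between every lower and every upper bound, so these bounds are
    -- compatible in pairs.
    project : ∀ {x} → Feasible P y x → Feasible (eliminate P) y (tail x)
    project feas@(box , _) =
      box ∘ suc ,
      All-concatMap⁺ (combineAll (bounds P)) λ {b} b∈ →
        All-concatMap⁺ (combine b) λ {b′} b′∈ →
          combine-nonNeg b b′ (All.lookup bs b∈) (All.lookup bs b′∈)
      where bs = feasible⇒bounds feas

    module _ {x : Vector Carrier k} (feas : Feasible (eliminate P) y x) where
      private
        combined : ∀ {b b′} → b ∈ bounds P → b′ ∈ bounds P → All (NonNeg x y) (combine b b′)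
        combined {b} b∈ b′∈ =
          All-concatMap⁻ (combine b) (All-concatMap⁻ (combineAll (bounds P)) (proj₂ feas) b∈) b′∈

        -- Constraints that are not upper bounds get the value of parameter 0, that is 1. The box
        -- imposes this bound anyway, so the minimum is unaffected.
        cap : Bound k (suc p) → Carrier
        cap (upper φ) = ⟦ φ ⟧ x y
        cap _         = ⟦ parameter {k} {suc p} zero ⟧ x y

        tightest : Bound k (suc p)
        tightest = argmin cap (upper (parameter zero)) (bounds P)

        -- The minimum of the upper bounds. Each lower bound was paired with each upper bound, so
        -- none exceeds this value.
        greatest : Carrier
        greatest = cap tightest

        lower-holds : ∀ φ → lower φ ∈ bounds P → 0# ≤ ⟦ φ ⟧ x y + greatest
        lower-holds φ φ∈ =
          argmin-all cap {P = λ b → 0# ≤ ⟦ φ ⟧ x y + cap b} below-one (All.tabulate below-cap)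
          where
          below : ∀ ψ → upper ψ ∈ bounds P → 0# ≤ ⟦ φ ⟧ x y + ⟦ ψ ⟧ x y
          below ψ ψ∈ = ≤-respʳ-≈ (⊕-value φ ψ x y) (All.head (combined φ∈ ψ∈))

          below-one : 0# ≤ ⟦ φ ⟧ x y + ⟦ parameter {k} {suc p} zero ⟧ x y
          below-one = below (parameter zero) (here ≡.refl)

          below-cap : ∀ {b} → b ∈ bounds P → 0# ≤ ⟦ φ ⟧ x y + cap b
          below-cap {upper ψ} ψ∈ = below ψ ψ∈
          below-cap {lower _} _  = below-one
          below-cap {free _}  _  = below-one

        holds : ∀ {b} → b ∈ bounds P → Holds greatest x y b
        holds {lower φ} b∈ = lower-holds φ b∈
        holds {upper φ} b∈ = All.lookup (f[argmin]≤f[xs] {f = cap} (upper (parameter zero)) (bounds P)) b∈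
        holds {free φ}  b∈ = All.head (combined b∈ b∈)

        feasible : Feasible P y (greatest Vector.∷ x)
        feasible = box , All.tabulate λ {φ} φ∈ →
          bound⇒nonNeg φ (greatest Vector.∷ x) y (holds (there (there (∈-map⁺ bound φ∈))))
          where
          box : InBox (greatest Vector.∷ x)
          box zero    =
            ≤-respʳ-≈ (trans (+-congʳ (0̂-value x y)) (+-identityˡ _)) (holds (there (here ≡.refl))) ,
            ≤-respʳ-≈ (trans (parameter-value zero x y) y₀≈1) (holds (here ≡.refl))
          box (suc i) = proj₁ feas i

        maximal : ∀ {z} → Feasible P y (z Vector.∷ x) → z ≤ greatest
        maximal {z} feas′ = argmin-all cap {P = λ b → z ≤ cap b}
          (All.lookup bs (here ≡.refl)) (All.map (λ {b} → below b) bs)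
          where
          bs = feasible⇒bounds feas′
          below : ∀ b → Holds z x y b → z ≤ cap b
          below (upper φ) z≤φ = z≤φ
          below (lower φ) _   = All.lookup bs (here ≡.refl)
          below (free φ)  _   = All.lookup bs (here ≡.refl)

      -- Back substitution. That the value is feasible serves to decide feasibility; that it is the
      -- largest one serves to maximise a single unknown.
      extend : ∃[ x₀ ] Feasible P y (x₀ Vector.∷ x) × (∀ {z} → Feasible P y (z Vector.∷ x) → z ≤ x₀)
      extend = greatest , feasible , maximal

  -- The result constrains the parameters alone: when parameter 0 is 1, it holds exactly if the
  -- original system is solvable.
  eliminateAll : ∀ {k p} → List (Form k (suc p)) → List (Form 0 (suc p))
  eliminateAll {zero}  P = P
  eliminateAll {suc k} P = eliminateAll (eliminate P)

  module _ {p} (y : Vector Carrier (suc p)) (y₀≈1 : head y ≈ 1#) where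

    projectAll : ∀ {k} (P : List (Form k (suc p))) {x} →
                 Feasible P y x → All (NonNeg Vector.[] y) (eliminateAll P)
    projectAll {zero}  P (_ , 0≤P) = 0≤P
    projectAll {suc k} P feas      = projectAll (eliminate P) (project y y₀≈1 P feas)

    extendAll : ∀ {k} (P : List (Form k (suc p))) →
                All (NonNeg Vector.[] y) (eliminateAll P) → ∃ (Feasible P y)
    extendAll {zero}  P 0≤P = Vector.[] , (λ ()) , 0≤P
    extendAll {suc k} P 0≤P = step (extendAll (eliminate P) 0≤P)
      where
      step : ∃ (Feasible (eliminate P) y) → ∃ (Feasible P y)
      step (x , feas) = let x₀ , feas′ , _ = extend y y₀≈1 P feas in x₀ Vector.∷ x , feas′

    -- Without unknowns, only comparisons of given numbers with 0 remain, and the order is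
    -- decidable.
    feasible? : ∀ {k} (P : List (Form k (suc p))) → Dec (∃ (Feasible P y))
    feasible? P = map′ (extendAll P) (λ (x , feas) → projectAll P {x} feas)
      (All.all? (λ φ → 0# ≤? ⟦ φ ⟧ Vector.[] y) (eliminateAll P))

  -- Maximising a linear form over a polytope.

  one : Vector Carrier 1
  one = const 1#

  -- Parameter 0 is the constant 1 and parameter 1 carries a level t, so eliminating all unknowns
  -- leaves conditions on t.
  withLevel : Carrier → Vector Carrier 2
  withLevel t = 1# Vector.∷ const t

  infixl 6 _⊕_·level

  _⊕_·level : ∀ {k} → Form k 1 → Carrier → Form k 2
  φ ⊕ b ·level = form (coef φ) (head (par φ) Vector.∷ const b)

  level-value : ∀ {k} (φ : Form k 1) b x t → ⟦ φ ⊕ b ·level ⟧ x (withLevel t) ≈ ⟦ φ ⟧ x one + b * t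
  level-value φ b x t =
    solve 4 (λ d q z s → d :+ (q :+ (s :+ z)) := (d :+ (q :+ z)) :+ s) refl
      (dot (coef φ) x) (head (par φ) * 1#) 0# (b * t)

  -- Once the original unknowns are gone, the level becomes the only unknown, and one more
  -- elimination yields its largest value.
  levelAsUnknown : Form 0 2 → Form 1 1
  levelAsUnknown φ = form (tail (par φ)) (const (head (par φ)))

  levelAsUnknown-value : ∀ (φ : Form 0 2) t →
    ⟦ φ ⟧ Vector.[] (withLevel t) ≈ ⟦ levelAsUnknown φ ⟧ (const t) one
  levelAsUnknown-value φ t =
    solve 3 (λ z q s → z :+ (q :+ (s :+ z)) := (s :+ z) :+ (q :+ z)) refl
      0# (head (par φ) * 1#) (par φ (suc zero) * t)

  maximum : (E : List (Form 1 1)) → ∃[ s ] Feasible E one (const s) →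
            ∃[ t ] Feasible E one (const t) × (∀ {s} → Feasible E one (const s) → s ≤ t)
  maximum E (s , feas) = step (extend one refl E {x} (project one refl E {const s} feas))
    where
    x : Vector Carrier 0
    x = tail {n = 0} (const s)

    step : ∃[ t ] Feasible E one (t Vector.∷ x) × (∀ {z} → Feasible E one (z Vector.∷ x) → z ≤ t) →
           ∃[ t ] Feasible E one (const t) × (∀ {s} → Feasible E one (const s) → s ≤ t)
    -- `const t` and `t Vector.∷ x` are only pointwise equal. Forms take the same value on both by
    -- computation, while the box condition is restated at its single index.
    step (t , (box , 0≤E) , t-max) =
      t , ((λ _ → box zero) , 0≤E) , λ (box′ , 0≤E′) → t-max ((λ { zero → box′ zero }) , 0≤E′)

  module _ {k} (P : List (Form k 1)) (ℓ : Form k 1)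
           (0≤ℓ≤1 : ∀ {x} → Feasible P one x → 0# ≤ ⟦ ℓ ⟧ x one × ⟦ ℓ ⟧ x one ≤ 1#) where
    private
      -- The pairs (x , t) with x feasible and t ≤ ℓ x; eliminating x leaves the
      -- attainable values of t.
      hypograph : List (Form k 2)
      hypograph = (ℓ ⊕ - 1# ·level) ∷ map (_⊕ 0# ·level) P

      levels : List (Form 1 1)
      levels = map levelAsUnknown (eliminateAll hypograph)

      constant-value : ∀ (φ : Form k 1) x t → ⟦ φ ⊕ 0# ·level ⟧ x (withLevel t) ≈ ⟦ φ ⟧ x one
      constant-value φ x t = trans (level-value φ 0# x t) (trans (+-congˡ (zeroˡ t)) (+-identityʳ _))

      slack-value : ∀ x t → ⟦ ℓ ⊕ - 1# ·level ⟧ x (withLevel t) ≈ ⟦ ℓ ⟧ x one - t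
      slack-value x t = trans (level-value ℓ (- 1#) x t) (+-congˡ (-1*x≈-x t))

      -- At the level t = ℓ x the slack is 0. The assumed range of `ℓ` puts this level into [0, 1],
      -- where unknowns must lie.
      attained : ∀ {x} → Feasible P one x → Feasible levels one (const (⟦ ℓ ⟧ x one))
      attained {x} feas@(box , 0≤P) =
        (λ _ → 0≤ℓ≤1 feas) ,
        map⁺ (All.map (λ {φ} → ≤-respʳ-≈ (levelAsUnknown-value φ t)) (projectAll (withLevel t) refl hypograph
          ( box
          , ≤-respʳ-≈ (sym (slack-value x t)) (x≤y⇒0≤y-x ≤-refl)
          ∷ map⁺ (All.map (λ {φ} → ≤-respʳ-≈ (sym (constant-value φ x t))) 0≤P) )))
        where t = ⟦ ℓ ⟧ x one

      attain : ∀ {t} → Feasible levels one (const t) → ∃[ x ] Feasible P one x × t ≤ ⟦ ℓ ⟧ x one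
      attain {t} (_ , 0≤L) = attained-by (extendAll (withLevel t) refl hypograph
        (All.map (λ {φ} → ≤-respʳ-≈ (sym (levelAsUnknown-value φ t))) (map⁻ 0≤L)))
        where
        attained-by : ∃ (Feasible hypograph (withLevel t)) → ∃[ x ] Feasible P one x × t ≤ ⟦ ℓ ⟧ x one
        attained-by (x , box , 0≤slack ∷ 0≤P) =
          x , (box , All.map (λ {φ} → ≤-respʳ-≈ (constant-value φ x t)) (map⁻ 0≤P)) ,
          0≤y-x⇒x≤y (≤-respʳ-≈ (slack-value x t) 0≤slack)

    -- The value at any feasible point is an attainable level, hence at most the largest level t,
    -- and back substitution gives a point whose value is at least t.
    maximise : ∃ (Feasible P one) →
               ∃[ x ] Feasible P one x × (∀ {z} → Feasible P one z → ⟦ ℓ ⟧ z one ≤ ⟦ ℓ ⟧ x one)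
    maximise (x , feas) = step (maximum levels (⟦ ℓ ⟧ x one , attained feas))
      where
      step : ∃[ t ] Feasible levels one (const t) × (∀ {s} → Feasible levels one (const s) → s ≤ t) →
             ∃[ x ] Feasible P one x × (∀ {z} → Feasible P one z → ⟦ ℓ ⟧ z one ≤ ⟦ ℓ ⟧ x one)
      step (t , feas-t , t-max) =
        let x* , feas* , t≤ℓx* = attain feas-t in
        x* , feas* , λ feas′ → ≤-trans (t-max (attained feas′)) t≤ℓx*

-- Lexicographic maximisation of a list of linear forms.

module LexicographicMaximum {c ℓ₁ ℓ₂} (R : Reals c ℓ₁ ℓ₂) where
  open OrderedField R
  open LinearInequalities R
  open ≤-Reasoning

  lexOrder : DecTotalOrder c (c ⊔ ℓ₁) (c ⊔ ℓ₁ ⊔ ℓ₂)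
  lexOrder = Lex.≤-decTotalOrder decTotalOrder

  open DecTotalOrder lexOrder public
    using ()
    renaming (_≈_ to _≋_; _≤_ to _≤ₗₑₓ_; trans to ≤ₗₑₓ-trans; reflexive to ≤ₗₑₓ-reflexive)

  values : ∀ {k} → List (Form k 1) → Vector Carrier k → List Carrier
  values ℓs x = map (λ ℓ → ⟦ ℓ ⟧ x one) ℓs

  NonNeg-⊖⁺ : ∀ {k p} (φ ψ : Form k p) x y → ⟦ ψ ⟧ x y ≤ ⟦ φ ⟧ x y → NonNeg x y (φ ⊖ ψ)
  NonNeg-⊖⁺ φ ψ x y ψ≤φ = ≤-respʳ-≈ (sym (⊖-value φ ψ x y)) (x≤y⇒0≤y-x ψ≤φ)

  NonNeg-⊖⁻ : ∀ {k p} (φ ψ : Form k p) x y → NonNeg x y (φ ⊖ ψ) → ⟦ ψ ⟧ x y ≤ ⟦ φ ⟧ x y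
  NonNeg-⊖⁻ φ ψ x y 0≤φ-ψ = 0≤y-x⇒x≤y (≤-respʳ-≈ (⊖-value φ ψ x y) 0≤φ-ψ)

  constant : ∀ {k} → Carrier → Form k 1
  constant s = s ⊙ parameter zero

  constant-value : ∀ {k} s (x : Vector Carrier k) → ⟦ constant s ⟧ x one ≈ s
  constant-value s x = trans (⊙-value s (parameter zero) x one)
    (trans (*-congˡ (parameter-value zero x one)) (*-identityʳ s))

  -- Maximise the first form, pin it to its maximum, and continue with the rest.
  lexMaximise : ∀ {k} (P : List (Form k 1)) ℓs →
    (∀ {x} → Feasible P one x → All (λ ℓ → 0# ≤ ⟦ ℓ ⟧ x one × ⟦ ℓ ⟧ x one ≤ 1#) ℓs) →
    ∃ (Feasible P one) →
    ∃[ x ] Feasible P one x × (∀ {z} → Feasible P one z → values ℓs z ≤ₗₑₓ values ℓs x)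
  lexMaximise P []       _     (x , feas) = x , feas , λ _ → base tt
  lexMaximise {k} P (ℓ ∷ ℓs) ℓs∈[0,1] feasible =
    pin (maximise P ℓ (λ feas → All.head (ℓs∈[0,1] feas)) feasible)
    where
    pin : ∃[ x ] Feasible P one x × (∀ {z} → Feasible P one z → ⟦ ℓ ⟧ z one ≤ ⟦ ℓ ⟧ x one) →
          ∃[ x ] Feasible P one x × (∀ {z} → Feasible P one z → values (ℓ ∷ ℓs) z ≤ₗₑₓ values (ℓ ∷ ℓs) x)
    pin (x , (box , 0≤P) , ℓ≤t) =
      continue (lexMaximise P′ ℓs (λ (box , 0≤P′) → All.tail (ℓs∈[0,1] (box , All.tail 0≤P′)))
                 (x , box , pinned⁺ ≤-refl ∷ 0≤P))
      where
      t = ⟦ ℓ ⟧ x one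
      -- One inequality pins `ℓ`, since t is already its upper bound on P.
      P′ = (ℓ ⊖ constant t) ∷ P

      pinned⁺ : ∀ {z} → t ≤ ⟦ ℓ ⟧ z one → NonNeg z one (ℓ ⊖ constant t)
      pinned⁺ {z} t≤ℓz = NonNeg-⊖⁺ ℓ (constant t) z one (≤-respˡ-≈ (sym (constant-value t z)) t≤ℓz)

      pinned⁻ : ∀ {z} → NonNeg z one (ℓ ⊖ constant t) → t ≤ ⟦ ℓ ⟧ z one
      pinned⁻ {z} 0≤ = ≤-respˡ-≈ (constant-value t z) (NonNeg-⊖⁻ ℓ (constant t) z one 0≤)

      continue : ∃[ x ] Feasible P′ one x × (∀ {z} → Feasible P′ one z → values ℓs z ≤ₗₑₓ values ℓs x) →
                 ∃[ x ] Feasible P one x × (∀ {z} → Feasible P one z → values (ℓ ∷ ℓs) z ≤ₗₑₓ values (ℓ ∷ ℓs) x)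
      continue (x* , (box* , 0≤pin ∷ 0≤P*) , ℓs-max) = x* , (box* , 0≤P*) , compare
        where
        t≤ℓx* : t ≤ ⟦ ℓ ⟧ x* one
        t≤ℓx* = pinned⁻ 0≤pin

        compare : ∀ {z} → Feasible P one z → values (ℓ ∷ ℓs) z ≤ₗₑₓ values (ℓ ∷ ℓs) x*
        -- A point that reaches t satisfies the pinned system, and the remaining forms decide; any
        -- other point loses strictly in the first component.
        compare {z} feas@(boxz , 0≤Pz) with t ≤? ⟦ ℓ ⟧ z one
        ... | yes t≤ℓz = next
          (antisym (≤-trans (ℓ≤t feas) t≤ℓx*) (≤-trans (ℓ≤t (box* , 0≤P*)) t≤ℓz))
          (ℓs-max (boxz , pinned⁺ t≤ℓz ∷ 0≤Pz))
        ... | no  t≰ℓz = this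
          ( ≤-trans (ℓ≤t feas) t≤ℓx*
          , λ ℓz≈ℓx* → t≰ℓz (≤-respʳ-≈ (sym ℓz≈ℓx*) t≤ℓx*))

-- Existence of the contrast maximum

module ContrastMaximum {c ℓ₁ ℓ₂} (R : Reals c ℓ₁ ℓ₂) {n : ℕ} (G : Graph n) where
  open OrderedField R
  open LinearInequalities R
  open LexicographicMaximum R
  open Graph G
  open ≤-Reasoning
  open TotalOrder.Eq totalOrder using (isEquivalence) renaming (setoid to ≈-setoid)
  open PermutationSetoid ≈-setoid using ()
    renaming (_↭_ to _↭ₛ_; prep to ↭ₛ-prep; ↭-refl to ↭ₛ-refl; ↭-trans to ↭ₛ-trans; ↭-sym to ↭ₛ-sym)
  open Sort decTotalOrder using (sort-↭; sort-↗)

  Edge : Set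
  Edge = Fin n × Fin n

  -- Signed and therefore linear in `f`, unlike `contrast`; the two agree once the edge is oriented
  -- to make the difference nonnegative.
  diff : (Fin n → Carrier) → Edge → Carrier
  diff f (u , v) = f u - f v

  module _ (f : Fin n → Carrier) where

    insertSorted : ∀ e {L} → AllPairs (λ e e′ → diff f e ≤ diff f e′) L →
                   ∃[ L′ ] L′ ∈ insertions e L × AllPairs (λ e e′ → diff f e ≤ diff f e′) L′
    insertSorted e []                     = _ , here ≡.refl , [] ∷ []
    insertSorted e {e₁ ∷ L} (e₁≤L ∷ L↗) with diff f e ≤? diff f e₁
    ... | yes e≤e₁ = _ , here ≡.refl , (e≤e₁ ∷ All.map (≤-trans e≤e₁) e₁≤L) ∷ e₁≤L ∷ L↗
    ... | no  e≰e₁ with insertSorted e L↗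
    ...   | L′ , L′∈ , L′↗ = e₁ ∷ L′ , there (∈-map⁺ (e₁ ∷_) L′∈) ,
      All-resp-↭ (↭-sym (insertions-↭ L L′∈)) (≰⇒≥ e≰e₁ ∷ e₁≤L) ∷ L′↗

    nonNegOrientation : ∀ e → ∃[ e′ ] e′ ∈ orientations e × 0# ≤ diff f e′
    nonNegOrientation e@(u , v) with total 0# (diff f e)
    ... | inj₁ 0≤e = e , here ≡.refl , 0≤e
    ... | inj₂ e≤0 = (v , u) , there (here ≡.refl) ,
      ≤-respʳ-≈ (⁻¹-anti-homo‿- (f u) (f v)) (x≤0⇒0≤-x e≤0)

    -- Insertion sort after orienting each edge, with the outcome located in the finite list of
    -- arrangements.
    sortedArrangement : ∀ es → ∃[ L ] L ∈ arrangements es × All (λ e → 0# ≤ diff f e) L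
                                    × AllPairs (λ e e′ → diff f e ≤ diff f e′) L
    sortedArrangement []       = [] , here ≡.refl , [] , []
    sortedArrangement (e ∷ es) with sortedArrangement es | nonNegOrientation e
    ... | L , L∈ , 0≤L , L↗ | e′ , e′∈ , 0≤e′ with insertSorted e′ L↗
    ...   | L′ , L′∈ , L′↗ = L′ , arrangements-∷⁺ es e′∈ L∈ L′∈ ,
      All-resp-↭ (↭-sym (insertions-↭ L L′∈)) (0≤e′ ∷ 0≤L) , L′↗

    orientation-contrast : ∀ {e e′} → e′ ∈ orientations e → 0# ≤ diff f e′ → diff f e′ ≈ contrast R G f e
    orientation-contrast (here ≡.refl)                 0≤e′ = sym (0≤x⇒∣x∣≈x 0≤e′)
    orientation-contrast {u , v} (there (here ≡.refl)) 0≤e′ =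
      sym (trans (∣x-y∣≈∣y-x∣ (f u) (f v)) (0≤x⇒∣x∣≈x 0≤e′))

    arrangement-↭ : ∀ es {L} → L ∈ arrangements es → All (λ e → 0# ≤ diff f e) L →
                    map (diff f) L ↭ₛ map (contrast R G f) es
    arrangement-↭ []       (here ≡.refl) _    = ↭ₛ-refl
    arrangement-↭ (e ∷ es) L′∈           0≤L′ with arrangements-∷⁻ es L′∈
    ... | e′ , L , e′∈ , L∈ , L′∈′ with All-resp-↭ (insertions-↭ L L′∈′) 0≤L′
    ...   | 0≤e′ ∷ 0≤L = ↭ₛ-trans
      (↭⇒↭ₛ′ isEquivalence (↭-map⁺ (diff f) (insertions-↭ L L′∈′)))
      (↭ₛ-prep (orientation-contrast e′∈ 0≤e′) (arrangement-↭ es L∈ 0≤L))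

    -- Two ascending lists that are permutations of each other agree entry by entry, so the sorting
    -- in `cont` is replaced by a fixed order of the edges.
    cont≋diffs : ∀ {L} → L ∈ arrangements edges → All (λ e → 0# ≤ diff f e) L →
                 AllPairs (λ e e′ → diff f e ≤ diff f e′) L → cont R G f ≋ map (diff f) L
    cont≋diffs L∈ 0≤L L↗ = ↗↭↗⇒≋ totalOrder (sort-↗ (map (contrast R G f) edges))
      (AllPairs⇒Sorted totalOrder (AllPairs.map⁺ L↗))
      (↭ₛ-trans (↭⇒↭ₛ′ isEquivalence (sort-↭ (map (contrast R G f) edges)))
        (↭ₛ-sym (arrangement-↭ edges L∈ 0≤L)))

  diffForm : Edge → Form n 1
  diffForm (u , v) = unknown u ⊖ unknown v

  diffForm-value : ∀ e f → ⟦ diffForm e ⟧ f one ≈ diff f e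
  diffForm-value (u , v) f = trans (⊖-value (unknown u) (unknown v) f one)
    (+-cong (unknown-value u f one) (-‿cong (unknown-value v f one)))

  -- (L , a , b) stands for the greyscales f with f a ≈ 0 and f b ≈ 1 whose differences
  -- along L, an arrangement of the oriented edges, are nonnegative and ascending.
  Region : Set
  Region = List Edge × Fin n × Fin n

  -- Each difference is compared with all later ones, matching `AllPairs`.
  ascending : List Edge → List (Form n 1)
  ascending []      = []
  ascending (e ∷ L) = diffForm e ∷ map (λ e′ → diffForm e′ ⊖ diffForm e) L ++ ascending L

  -- Only f a ≤ 0 and 1 ≤ f b are imposed; the box supplies the opposite inequalities.
  constraints : Region → List (Form n 1)
  constraints (L , a , b) = (0̂ ⊖ unknown a) ∷ (unknown b ⊖ parameter zero) ∷ ascending L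

  module _ {f : Fin n → Carrier} where

    ascending⁺ : ∀ {L} → All (λ e → 0# ≤ diff f e) L → AllPairs (λ e e′ → diff f e ≤ diff f e′) L →
                 All (NonNeg f one) (ascending L)
    ascending⁺ []                _             = []
    ascending⁺ {e ∷ L} (0≤e ∷ 0≤L) (e≤L ∷ L↗) =
      ≤-respʳ-≈ (sym (diffForm-value e f)) 0≤e ∷
      ++⁺ (map⁺ (All.map (λ {e′} e≤e′ → NonNeg-⊖⁺ (diffForm e′) (diffForm e) f one
                   (≤-respˡ-≈ (sym (diffForm-value e f)) (≤-respʳ-≈ (sym (diffForm-value e′ f)) e≤e′))) e≤L))
          (ascending⁺ 0≤L L↗)

    ascending⁻ : ∀ L → All (NonNeg f one) (ascending L) →
                 All (λ e → 0# ≤ diff f e) L × AllPairs (λ e e′ → diff f e ≤ diff f e′) L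
    ascending⁻ []      _           = [] , []
    ascending⁻ (e ∷ L) (0≤e ∷ 0≤) with ++⁻ (map (λ e′ → diffForm e′ ⊖ diffForm e) L) 0≤
    ... | e≤L , 0≤L with ascending⁻ L 0≤L
    ...   | L≥0 , L↗ =
      ≤-respʳ-≈ (diffForm-value e f) 0≤e ∷ L≥0 ,
      All.map (λ {e′} 0≤ → ≤-respˡ-≈ (diffForm-value e f) (≤-respʳ-≈ (diffForm-value e′ f)
                 (NonNeg-⊖⁻ (diffForm e′) (diffForm e) f one 0≤))) (map⁻ e≤L) ∷ L↗

  _∈ᴿ_ : (Fin n → Carrier) → Region → Set (c ⊔ ℓ₂)
  f ∈ᴿ r = Feasible (constraints r) one f

  regions : List Region
  regions = cartesianProduct (arrangements edges) (cartesianProduct (allFin n) (allFin n))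

  -- The region is read off from where `f` takes the values 0 and 1 and from the sorted order of its
  -- differences. Thus the finitely many regions cover all greyscales.
  greyscale⇒region : ∀ {f} → IsGreyscale R G f → Any (f ∈ᴿ_) regions
  greyscale⇒region {f} grey =
    let L , L∈ , 0≤L , L↗ = sortedArrangement f edges
        a , fa≈0 = attains-0
        b , fb≈1 = attains-1
        0≤-fa = NonNeg-⊖⁺ 0̂ (unknown a) f one
          (≤-reflexive (trans (unknown-value a f one) (trans fa≈0 (sym (0̂-value f one)))))
        0≤fb-1 = NonNeg-⊖⁺ (unknown b) (parameter zero) f one
          (≤-reflexive (trans (parameter-value zero f one)
            (trans (sym fb≈1) (sym (unknown-value b f one)))))
    in lose (∈-cartesianProduct⁺ L∈ (∈-cartesianProduct⁺ (∈-allFin a) (∈-allFin b)))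
            ((λ v → nonNegative v , atMostOne v) , 0≤-fa ∷ 0≤fb-1 ∷ ascending⁺ 0≤L L↗)
    where open IsGreyscale grey

  region⇒greyscale : ∀ {f} r → f ∈ᴿ r → IsGreyscale R G f
  region⇒greyscale {f} (L , a , b) (box , 0≤-a ∷ 0≤b-1 ∷ _) = record
    { nonNegative = λ v → proj₁ (box v)
    ; atMostOne   = λ v → proj₂ (box v)
    ; attains-0   = a , antisym
        (≤-respˡ-≈ (unknown-value a f one) (≤-respʳ-≈ (0̂-value f one) (NonNeg-⊖⁻ 0̂ (unknown a) f one 0≤-a)))
        (proj₁ (box a))
    ; attains-1   = b , antisym (proj₂ (box b))
        (≤-respˡ-≈ (parameter-value zero f one) (≤-respʳ-≈ (unknown-value b f one)
          (NonNeg-⊖⁻ (unknown b) (parameter zero) f one 0≤b-1)))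
    }

  -- This is the range condition of `lexMaximise`. The lower bound is a constraint of the region;
  -- the upper one follows from f u ≤ 1 and 0 ≤ f v.
  diffForms∈[0,1] : ∀ {f} r → f ∈ᴿ r →
    All (λ ℓ → 0# ≤ ⟦ ℓ ⟧ f one × ⟦ ℓ ⟧ f one ≤ 1#) (map diffForm (proj₁ r))
  diffForms∈[0,1] {f} (L , _) (box , _ ∷ _ ∷ 0≤L) =
    map⁺ (All.map (λ {e} 0≤e → ≤-respʳ-≈ (sym (diffForm-value e f)) 0≤e ,
                               ≤-respˡ-≈ (sym (diffForm-value e f)) (diff≤1 e))
                  (proj₁ (ascending⁻ L 0≤L)))
    where
    diff≤1 : ∀ e → diff f e ≤ 1#
    diff≤1 (u , v) = begin
      f u - f v ≤⟨ +-mono-≤ (proj₂ (box u)) (≤-respʳ-≈ -0#≈0# -fv≤-0) ⟩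
      1# + 0#   ≈⟨ +-identityʳ 1# ⟩
      1#        ∎
      where
      -fv≤-0 : - f v ≤ - 0#
      -fv≤-0 = 0≤y-x⇒x≤y (begin
        0#             ≤⟨ proj₁ (box v) ⟩
        f v            ≈⟨ -‿involutive (f v) ⟨
        - - f v        ≈⟨ +-identityˡ _ ⟨
        0# - - f v     ≈⟨ +-congʳ -0#≈0# ⟨
        - 0# - - f v   ∎)

  map-diffForm : ∀ L f → values (map diffForm L) f ≋ map (diff f) L
  map-diffForm []      f = []
  map-diffForm (e ∷ L) f = diffForm-value e f ∷ map-diffForm L f

  cont≋values : ∀ {f L ab} → (L , ab) ∈ regions → f ∈ᴿ (L , ab) → cont R G f ≋ values (map diffForm L) f
  cont≋values {f} {L} r∈ (_ , _ ∷ _ ∷ 0≤L) =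
    Pointwise.transitive trans
      (cont≋diffs f (proj₁ (∈-cartesianProduct⁻ (arrangements edges) _ r∈))
        (proj₁ (ascending⁻ L 0≤L)) (proj₂ (ascending⁻ L 0≤L)))
      (Pointwise.symmetric sym (map-diffForm L f))

  -- On a region the contrast vector lists the values of fixed linear forms, so linear programming
  -- applies to it.
  maximumOrEmpty-region : ∀ {r} → r ∈ regions → MaximumOrEmpty lexOrder (cont R G) (_∈ᴿ r)
  maximumOrEmpty-region {r@(L , ab)} r∈ with feasible? one refl (constraints r)
  ... | no  infeasible = inj₂ λ g∈ → infeasible (_ , g∈)
  ... | yes feasible   = inj₁ (transfer (lexMaximise (constraints r) (map diffForm L) (diffForms∈[0,1] r) feasible))
    where
    transfer : ∃[ f ] f ∈ᴿ r × (∀ {g} → g ∈ᴿ r → values (map diffForm L) g ≤ₗₑₓ values (map diffForm L) f) →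
               ∃[ f ] f ∈ᴿ r × (∀ {g} → g ∈ᴿ r → cont R G g ≤ₗₑₓ cont R G f)
    transfer (f , f∈ , f-max) = f , f∈ , λ g∈ →
      ≤ₗₑₓ-trans (≤ₗₑₓ-reflexive (cont≋values r∈ g∈))
        (≤ₗₑₓ-trans (f-max g∈) (≤ₗₑₓ-reflexive (Pointwise.symmetric sym (cont≋values r∈ f∈))))

  maximalGreyscale : ∃ (IsGreyscale R G) →
                     ∃[ f ] IsGreyscale R G f × (∀ g → IsGreyscale R G g → cont R G g ≤ₗₑₓ cont R G f)
  maximalGreyscale (_ , grey₀)
    with maximumOrEmpty-⋃ lexOrder (cont R G) (λ r → _∈ᴿ r) regions maximumOrEmpty-region
  ... | inj₂ none             = contradiction (greyscale⇒region grey₀) none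
  ... | inj₁ (f , f∈ , f-max) with find f∈
  ...   | r , _ , f∈r = f , region⇒greyscale r f∈r , λ _ grey → f-max (greyscale⇒region grey)

-- The value of the lightest tone

module NaturalMultiples {c ℓ₁ ℓ₂} (R : Reals c ℓ₁ ℓ₂) where
  open OrderedField R
  open ≤-Reasoning

  0≤fromℕ : ∀ k → 0# ≤ fromℕ k
  0≤fromℕ zero    = ≤-refl
  0≤fromℕ (suc k) = ≤-respˡ-≈ (+-identityˡ 0#) (+-mono-≤ 0≤1 (0≤fromℕ k))

  fromℕ-mono-≤ : ∀ {i j} → i ℕ.≤ j → fromℕ i ≤ fromℕ j
  fromℕ-mono-≤ {j = j} z≤n = 0≤fromℕ j
  fromℕ-mono-≤ (s≤s i≤j)   = +-monoʳ-≤ 1# (fromℕ-mono-≤ i≤j)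

  fromℕ-suc≉0 : ∀ k → ¬ fromℕ (suc k) ≈ 0#
  fromℕ-suc≉0 k 1+k≈0 = 0≉1 (antisym 0≤1 (begin
    1#             ≈⟨ +-identityʳ 1# ⟨
    1# + 0#        ≤⟨ +-monoʳ-≤ 1# (0≤fromℕ k) ⟩
    fromℕ (suc k)  ≈⟨ 1+k≈0 ⟩
    0#             ∎))

  fromℕ-suc-1 : ∀ k → fromℕ (suc k) - 1# ≈ fromℕ k
  fromℕ-suc-1 k = trans (+-congʳ (+-comm 1# (fromℕ k))) (//-rightDividesʳ 1# (fromℕ k))

  suc-*-≤ : ∀ {i j t} → 0# ≤ t → i ℕ.< j → t + fromℕ i * t ≤ fromℕ j * t
  suc-*-≤ {i} {j} {t} 0≤t i<j = begin
    t + fromℕ i * t      ≈⟨ +-congʳ (*-identityˡ t) ⟨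
    1# * t + fromℕ i * t ≈⟨ distribʳ t 1# (fromℕ i) ⟨
    fromℕ (suc i) * t    ≤⟨ *-monoˡ-≤-nonNeg 0≤t (fromℕ-mono-≤ i<j) ⟩
    fromℕ j * t          ∎

  -- For positive t the number j is the integer part of x / t, found by searching downwards from k.
  floor : ∀ {x t} k → 0# ≤ x → ¬ fromℕ k * t ≤ x →
          ∃[ j ] j ℕ.< k × fromℕ j * t ≤ x × ¬ fromℕ (suc j) * t ≤ x
  floor {x} {t} zero    0≤x x<0 = contradiction (≤-respˡ-≈ (sym (zeroˡ t)) 0≤x) x<0
  floor {x} {t} (suc k) 0≤x x<[1+k]t with fromℕ k * t ≤? x
  ... | yes kt≤x = k , ℕ.≤-refl , kt≤x , x<[1+k]t
  ... | no  kt≰x with floor k 0≤x kt≰x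
  ...   | j , j<k , jt≤x , x<[1+j]t = j , ℕ.m<n⇒m<1+n j<k , jt≤x , x<[1+j]t

module LightestTone {c ℓ₁ ℓ₂} (R : Reals c ℓ₁ ℓ₂) {n : ℕ} (G : Graph n) where
  open OrderedField R
  open NaturalMultiples R
  open LexicographicMaximum R
  open ContrastMaximum R G
  open Graph G
  open ≤-Reasoning
  open Sort decTotalOrder using (sort-↭; sort-↗)
  open TotalOrder.Eq totalOrder using () renaming (reflexive to ≈-reflexive)

  record Lightest (f : Fin n → Carrier) (t : Carrier) (ts : List Carrier) : Set (c ⊔ ℓ₂) where
    field
      cont≡    : cont R G f ≡ t ∷ ts
      minimal  : ∀ {e} → e ∈ edges → t ≤ contrast R G f e
      attained : ∃[ e ] e ∈ edges × t ≡ contrast R G f e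

  open Lightest

  lightest : ∀ f {e} → e ∈ edges → ∃[ t ] ∃[ ts ] Lightest f t ts
  lightest f e∈ = first (cont R G f) ≡.refl
    (Sorted⇒AllPairs totalOrder (sort-↗ contrasts)) (sort-↭ contrasts)
    where
    contrasts = map (contrast R G f) edges

    first : ∀ ts → cont R G f ≡ ts → AllPairs _≤_ ts → ts ↭ contrasts → ∃[ t ] ∃[ ts′ ] Lightest f t ts′
    -- The given edge contributes an entry, so the contrast vector is not empty.
    first []       _  _          []↭ with ∈-resp-↭ (↭-sym []↭) (∈-map⁺ (contrast R G f) e∈)
    ... | ()
    first (t ∷ ts) eq (t≤ts ∷ _) ts↭ = t , ts , record
      { cont≡    = eq
      ; minimal  = λ e∈ → All.lookup (map⁻ (All-resp-↭ ts↭ (≤-refl ∷ t≤ts))) e∈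
      ; attained = ∈-map⁻ (contrast R G f) (∈-resp-↭ ts↭ (here ≡.refl))
      }

  minimal-adj : ∀ {f t ts u v} → Lightest f t ts → Adj u v → t ≤ ∣ f u - f v ∣
  minimal-adj {f} {u = u} {v} l adj with ∈-edges⁺ G adj
  ... | inj₁ uv∈ = minimal l uv∈
  ... | inj₂ vu∈ = ≤-respʳ-≈ (∣x-y∣≈∣y-x∣ (f v) (f u)) (minimal l vu∈)

  ≤ₗₑₓ-lightest : ∀ {f g s t ss ts} → Lightest f s ss → Lightest g t ts → cont R G f ≤ₗₑₓ cont R G g → s ≤ t
  ≤ₗₑₓ-lightest lf lg f≤g with ≡.subst₂ _≤ₗₑₓ_ (cont≡ lf) (cont≡ lg) f≤g
  ... | this (s≤t , _) = s≤t
  ... | next s≈t _     = ≤-reflexive s≈t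

  module _ (m : ℕ) (minimal-χ : ∀ k → Colourable k → suc (suc m) ℕ.≤ k) where
    private
      -- The chromatic number is m + 2, so this is χ - 1, and it is nonzero.
      K = fromℕ (suc m)
      K≉0 = fromℕ-suc≉0 m

      0≤K⁻¹ : 0# ≤ K ⁻¹
      0≤K⁻¹ = ⁻¹-nonNegative (0≤fromℕ (suc m)) K≉0

    module _ (colourable : Colourable (suc (suc m))) where
      private
        colour = proj₁ colourable

      evenlySpaced : Fin n → Carrier
      evenlySpaced v = fromℕ (Fin.toℕ (colour v)) * K ⁻¹

      -- By minimality the first and the last colour both occur; they give the tones 0 and 1.
      evenlySpaced-isGreyscale : IsGreyscale R G evenlySpaced
      evenlySpaced-isGreyscale = record
        { nonNegative = λ v → *-nonNegative (0≤fromℕ (Fin.toℕ (colour v))) 0≤K⁻¹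
        ; atMostOne   = λ v → ≤-respʳ-≈ (⁻¹-inverseʳ K K≉0)
            (*-monoˡ-≤-nonNeg 0≤K⁻¹ (fromℕ-mono-≤ (Fin.toℕ≤pred[n] (colour v))))
        ; attains-0   = first , trans (*-congʳ (≈-reflexive (≡.cong (fromℕ ∘ Fin.toℕ) first-used))) (zeroˡ (K ⁻¹))
        ; attains-1   = last , trans (*-congʳ (≈-reflexive (≡.cong fromℕ
            (≡.trans (≡.cong Fin.toℕ last-used) (Fin.toℕ-fromℕ (suc m)))))) (⁻¹-inverseʳ K K≉0)
        }
        where
        first = proj₁ (colour-used G minimal-χ colourable zero)
        first-used = proj₂ (colour-used G minimal-χ colourable zero)
        last = proj₁ (colour-used G minimal-χ colourable (Fin.fromℕ (suc m)))
        last-used = proj₂ (colour-used G minimal-χ colourable (Fin.fromℕ (suc m)))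

      -- The colours of adjacent vertices differ by at least 1 as numbers, and the scaling turns
      -- this into 1 / K.
      evenlySpaced-contrast : ∀ {u v} → Adj u v → K ⁻¹ ≤ ∣ evenlySpaced u - evenlySpaced v ∣
      evenlySpaced-contrast {u} {v} adj with ℕ.<-cmp (Fin.toℕ (colour u)) (Fin.toℕ (colour v))
      ... | tri< cu<cv _ _ = ≤-respʳ-≈ (∣x-y∣≈∣y-x∣ (evenlySpaced v) (evenlySpaced u))
        (≤-trans (x+y≤z⇒x≤z-y (suc-*-≤ 0≤K⁻¹ cu<cv)) (x≤x⊔y _ _))
      ... | tri≈ _ cu≡cv _ = contradiction (Fin.toℕ-injective cu≡cv) (proj₂ colourable u v adj)
      ... | tri> _ _ cv<cu = ≤-trans (x+y≤z⇒x≤z-y (suc-*-≤ 0≤K⁻¹ cv<cu)) (x≤x⊔y _ _)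

    -- If t > 1 / K, then every f v is below K t, so the integer part of f v / t takes at most m + 1
    -- values. It properly colours the graph with too few colours.
    contrast-bound : ∀ {f t} → IsGreyscale R G f → (∀ {u v} → Adj u v → t ≤ ∣ f u - f v ∣) → t ≤ K ⁻¹
    contrast-bound {f} {t} grey t≤contrast with t ≤? K ⁻¹
    ... | yes t≤K⁻¹ = t≤K⁻¹
    ... | no  t≰K⁻¹ = contradiction (minimal-χ (suc m) (colour , proper)) ℕ.1+n≰n
      where
      open IsGreyscale grey

      Kt≰f : ∀ v → ¬ K * t ≤ f v
      Kt≰f v Kt≤f = t≰K⁻¹ (begin
        t              ≈⟨ x⁻¹*[x*y]≈y t K≉0 ⟨
        K ⁻¹ * (K * t) ≤⟨ *-monoʳ-≤-nonNeg 0≤K⁻¹ (≤-trans Kt≤f (atMostOne v)) ⟩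
        K ⁻¹ * 1#      ≈⟨ *-identityʳ (K ⁻¹) ⟩
        K ⁻¹           ∎)

      level : ∀ v → ∃[ j ] j ℕ.< suc m × fromℕ j * t ≤ f v × ¬ fromℕ (suc j) * t ≤ f v
      level v = floor (suc m) (nonNegative v) (Kt≰f v)

      colour : Fin n → Fin (suc m)
      colour v = Fin.fromℕ< (proj₁ (proj₂ (level v)))

      -- Both values lie in the same half-open interval from j t to (j + 1) t.
      level-gap : ∀ {u v} → proj₁ (level u) ≡ proj₁ (level v) → ¬ t ≤ f u - f v
      level-gap {u} {v} eq t≤fu-fv with level u | level v | eq
      ... | j , _ , _ , fu< | .j , _ , jt≤fv , _ | ≡.refl = fu< (begin
        (1# + fromℕ j) * t   ≈⟨ distribʳ t 1# (fromℕ j) ⟩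
        1# * t + fromℕ j * t ≈⟨ +-congʳ (*-identityˡ t) ⟩
        t + fromℕ j * t      ≤⟨ +-mono-≤ t≤fu-fv jt≤fv ⟩
        f u - f v + f v      ≈⟨ //-rightDividesˡ (f v) (f u) ⟩
        f u                  ∎)

      proper : ∀ u v → Adj u v → colour u ≢ colour v
      proper u v adj cu≡cv with ∣-∣-sel (f u - f v)
      ... | inj₁ ∣∣≈ = level-gap same (≤-respʳ-≈ ∣∣≈ (t≤contrast adj))
        where same = Fin.fromℕ<-injective _ _ _ _ cu≡cv
      ... | inj₂ ∣∣≈ = level-gap (≡.sym same)
          (≤-respʳ-≈ (trans ∣∣≈ (⁻¹-anti-homo‿- (f u) (f v))) (t≤contrast adj))
        where same = Fin.fromℕ<-injective _ _ _ _ cu≡cv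

    -- The maximal greyscale beats the evenly spaced one, whose least contrast is at least 1 / K;
    -- `contrast-bound` gives the other inequality.
    lightestTone : Colourable (suc (suc m)) → ∃ (_∈ edges) → IsLightestTone R G ((fromℕ (suc (suc m)) - 1#) ⁻¹)
    lightestTone colourable (e , e∈) =
      let g = evenlySpaced colourable
          g-grey = evenlySpaced-isGreyscale colourable
          f , f-grey , f-max = maximalGreyscale (g , g-grey)
          s , ss , lg = lightest g e∈
          t , ts , lf = lightest f e∈
          (u , v) , uv∈ , s≡ = attained lg
          K⁻¹≤s = ≤-respʳ-≈ (≈-reflexive (≡.sym s≡)) (evenlySpaced-contrast colourable (∈-edges⁻ G uv∈))
          K⁻¹≤t = ≤-trans K⁻¹≤s (≤ₗₑₓ-lightest lg lf (f-max g g-grey))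
          t≤K⁻¹ = contrast-bound f-grey (minimal-adj lf)
          tone≈t = trans (⁻¹-cong (fromℕ-suc-1 (suc m))) (antisym K⁻¹≤t t≤K⁻¹)
          -- Only the head is exchanged, for an equal real number; the tail stays that of the
          -- maximal contrast vector.
          w≋cont = ≡.subst (((fromℕ (suc (suc m)) - 1#) ⁻¹ ∷ ts) ≋_) (≡.sym (cont≡ lf))
                     (tone≈t ∷ Pointwise.refl refl)
      in ts , (f , f-grey , w≋cont) ,
         λ g grey → ≤ₗₑₓ-trans (f-max g grey) (≤ₗₑₓ-reflexive (Pointwise.symmetric sym w≋cont))

open import Data.Nat.Base using (_≤_)

theorem3p5 : ∀ {c ℓ₁ ℓ₂} (R : Reals c ℓ₁ ℓ₂) (n : ℕ) (G : Graph n) →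
    2 ≤ n → Graph.Connected G →
    (χ : ℕ) → Graph.IsChromaticNumber G χ →
    IsLightestTone R G (Reals._⁻¹ R (Reals._-_ R (Reals.fromℕ R χ) (Reals.1# R)))
theorem3p5 R n G 2≤n connected χ (colourable , minimal) with connected⇒edge G 2≤n connected
-- An edge excludes χ ≤ 1: with no colours its endpoint cannot be coloured, and with one colour both
-- endpoints share it.
theorem3p5 R n G _ _ zero          ((colour , _) , _)      | u , _ with () ← colour u
theorem3p5 R n G _ _ (suc zero)    ((colour , proper) , _) | u , v , adj
  with zero ← colour u in cu≡0 | zero ← colour v in cv≡0 =
  contradiction (≡.trans cu≡0 (≡.sym cv≡0)) (proper u v adj)
theorem3p5 R n G _ _ (suc (suc m)) (colourable , minimal)  | u , v , adj =
  LightestTone.lightestTone R G m minimal colourable ([ (_ ,_) , (_ ,_) ]′ (∈-edges⁺ G adj))
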